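{- Let $G_1=K_3$ with vertices $x_1,y,z$. For $i\ge 2$, let $G_i$ be obtained from $G_{i-1}$ by adding a new vertex $x_i$ adjacent to exactly two vertices of $G_{i-1}$, these two being adjacent in $G_{i-1}$ (so that a new triangle is formed), in such a way that $G_i$ is a $2$-connected plane graph whose bounded faces are all triangles. Then $sn(G_i)=2$ for every $i\ge 1$.
   Context: Graphs are finite, undirected and simple. Let $G=(V,E)$ be a connected graph with chromatic number $\chi(G)=k\ge 2$. For $S\subset V$, a partial coloring on $G[S]$ is a proper coloring $\mathscr C_0$ of the induced subgraph $G[S]$ with colors from $\{1,\dots,k\}$ (not all colors need be used). It is a Sudoku coloring of $G$ if there is exactly one proper $k$-coloring $V\to\{1,\dots,k\}$ of $G$ whose restriction to $S$ is $\mathscr C_0$. The Sudoku number $sn(G)$ is the smallest $|S|$ such that $G[S]$ admits a Sudoku coloring of $G$. -}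

module Defs where

open import Data.Empty using (⊥)
open import Data.Fin using (Fin; zero; suc; punchIn; _<?_)
open import Data.Fin.Properties using (_≟_)
open import Data.Fin.Subset using (Subset; _∈_; ∣_∣)
open import Data.List using (length; filter; cartesianProduct; allFin)
open import Data.Nat using (ℕ; zero; suc; _+_; _≤_)
open import Data.Nat.GeneralisedArithmetic using (iterate)
open import Data.Product using (∃; ∃-syntax; ∃!; _×_; _,_)
open import Data.Sum using (_⊎_)
open import Function using (_∘_)
open import Function.Bundles using (_⇔_)
open import Relation.Binary using (Rel; Symmetric; Irreflexive; Decidable)
open import Relation.Binary.Construct.Closure.ReflexiveTransitive using (Star)
open import Relation.Binary.PropositionalEquality using (_≡_; _≢_; _≗_; refl; sym; ≢-sym)
open import Relation.Nullary using (¬_; yes; no)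
open import Relation.Nullary.Decidable using (¬?; _×-dec_; _⊎-dec_)
open import Level using (0ℓ)

record Graph (n : ℕ) : Set₁ where
  field
    Adj    : Rel (Fin n) 0ℓ
    adj?   : Decidable Adj
    symm   : Symmetric Adj
    irrefl : Irreflexive _≡_ Adj

open Graph public

K : ∀ n → Graph n
K n = record
  { Adj    = _≢_
  ; adj?   = λ u v → ¬? (u ≟ v)
  ; symm   = ≢-sym
  ; irrefl = λ u≡v u≢v → u≢v u≡v
  }

module _ {n : ℕ} (G : Graph n) (u v : Fin n) where

  -- The new vertex is `zero`; an old vertex w becomes `suc w`.
  AdjNew : Rel (Fin (suc n)) 0ℓ
  AdjNew zero    zero    = ⊥
  AdjNew zero    (suc w) = w ≡ u ⊎ w ≡ v
  AdjNew (suc w) zero    = w ≡ u ⊎ w ≡ v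
  AdjNew (suc w) (suc t) = Adj G w t

  adjNew? : Decidable AdjNew
  adjNew? zero    zero    = no λ ()
  adjNew? zero    (suc w) = (w ≟ u) ⊎-dec (w ≟ v)
  adjNew? (suc w) zero    = (w ≟ u) ⊎-dec (w ≟ v)
  adjNew? (suc w) (suc t) = adj? G w t

  adjNew-sym : Symmetric AdjNew
  adjNew-sym {zero}  {zero}  ()
  adjNew-sym {zero}  {suc w} e = e
  adjNew-sym {suc w} {zero}  e = e
  adjNew-sym {suc w} {suc t} e = symm G e

  adjNew-irrefl : Irreflexive _≡_ AdjNew
  adjNew-irrefl {zero}  refl ()
  adjNew-irrefl {suc w} refl e = irrefl G refl e

  addVertex : Graph (suc n)
  addVertex = record
    { Adj    = AdjNew
    ; adj?   = adjNew?
    ; symm   = λ {x} {y} → adjNew-sym {x} {y}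
    ; irrefl = λ {x} {y} → adjNew-irrefl {x} {y}
    }

deleteVertex : ∀ {n} → Graph (suc n) → Fin (suc n) → Graph n
deleteVertex G w = record
  { Adj    = λ a b → Adj G (punchIn w a) (punchIn w b)
  ; adj?   = λ a b → adj? G (punchIn w a) (punchIn w b)
  ; symm   = symm G
  ; irrefl = λ { refl → irrefl G refl }
  }

Connected : ∀ {n} → Graph n → Set
Connected G = ∀ u v → Star (Adj G) u v

TwoConnected : ∀ {n} → Graph (suc n) → Set
TwoConnected {n} G =
  3 ≤ suc n × Connected G × (∀ w → Connected (deleteVertex G w))

edgeCount : ∀ {n} → Graph n → ℕ
edgeCount {n} G =
  length (filter (λ { (u , v) → (u <? v) ×-dec adj? G u v })
                 (cartesianProduct (allFin n) (allFin n)))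

-- An oriented edge. The adjacency proof is irrelevant, so there is exactly
-- one dart for each ordered pair of adjacent vertices.
record Dart {n : ℕ} (G : Graph n) : Set where
  constructor dart
  field
    tail  : Fin n
    head  : Fin n
    .edge : Adj G tail head

open Dart public

reverse : ∀ {n} {G : Graph n} → Dart G → Dart G
reverse {G = G} (dart u v e) = dart v u (symm G e)

-- A drawing of a connected graph in the plane, as a combinatorial map:
-- `next` is the cyclic order of the darts around each vertex, faces are the
-- orbits of d ↦ next (reverse d) (boundary walks), and one face is the
-- unbounded one. For a connected graph, Euler's formula says that the surface
-- carrying the map is the sphere; `PlaneGraph` below is only used for
-- connected graphs.
record PlaneGraph {n : ℕ} (G : Graph n) : Set where
  field
    next      : Dart G → Dart G
    next-tail : ∀ d → tail (next d) ≡ tail d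
    next-cyc  : ∀ d d′ → tail d ≡ tail d′ → ∃[ m ] iterate next d m ≡ d′

  along : Dart G → Dart G
  along d = next (reverse d)

  field
    faceCount : ℕ
    face      : Dart G → Fin faceCount
    face-surj : ∀ f → ∃[ d ] face d ≡ f
    face-orb  : ∀ d d′ → face d ≡ face d′ ⇔ (∃[ m ] iterate along d m ≡ d′)
    outer     : Fin faceCount
    euler     : n + faceCount ≡ edgeCount G + 2

-- A boundary walk closing up after three steps has length exactly 3: its
-- length divides 3, and length 1 would give a loop.
BoundedFacesTriangles : ∀ {n} {G : Graph n} → PlaneGraph G → Set
BoundedFacesTriangles P =
  ∀ d → face d ≢ outer → iterate along d 3 ≡ d
  where open PlaneGraph P

module _ {n : ℕ} {G : Graph n} {u v : Fin n} where

  old : Dart G → Dart (addVertex G u v)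
  old (dart a b e) = dart (suc a) (suc b) e

  -- The drawing P′ restricts to P when the new vertex is erased: skipping
  -- darts to the new vertex in the rotations of P′ gives those of P, and the
  -- unbounded region of P′ lies in that of P.
  record Extends (P : PlaneGraph G) (P′ : PlaneGraph (addVertex G u v)) : Set where
    private
      module P  = PlaneGraph P
      module P′ = PlaneGraph P′
    field
      rotation :
        ∀ d → P′.next (old d) ≡ old (P.next d)
            ⊎ (head (P′.next (old d)) ≡ zero
               × P′.next (P′.next (old d)) ≡ old (P.next d))
      unbounded : ∀ d → P′.face (old d) ≡ P′.outer → P.face d ≡ P.outer

-- `Triangulated i G P`: G, drawn as P, is a possible G_i.
-- G_i has the i + 2 vertices x₁, y, z, x₂, …, x_i.
data Triangulated : (i : ℕ) (G : Graph (2 + i)) → PlaneGraph G → Set₁ where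
  base : (P : PlaneGraph (K 3)) → Triangulated 1 (K 3) P
  step : ∀ {i G P} → Triangulated i G P →
         (u v : Fin (2 + i)) → Adj G u v →
         (P′ : PlaneGraph (addVertex G u v)) → Extends P P′ →
         TwoConnected (addVertex G u v) →
         BoundedFacesTriangles P′ →
         Triangulated (suc i) (addVertex G u v) P′

Proper : ∀ {n k} → Graph n → (Fin n → Fin k) → Set
Proper G c = ∀ {u v} → Adj G u v → c u ≢ c v

IsChromaticNumber : ∀ {n} → Graph n → ℕ → Set
IsChromaticNumber {n} G k =
  (∃[ c ] Proper {n} {k} G c)
  × (∀ m (c : Fin n → Fin m) → Proper G c → k ≤ m)

-- Membership proofs v ∈ S are unique, so `colour` is just a function on S.
record PartialColouring {n : ℕ} (G : Graph n) (k : ℕ) (S : Subset n) : Set where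
  field
    colour : ∀ v → v ∈ S → Fin k
    proper : ∀ {u v} (p : u ∈ S) (q : v ∈ S) → Adj G u v → colour u p ≢ colour v q

IsSudokuColouring : ∀ {n k} {G : Graph n} {S : Subset n} →
                    PartialColouring G k S → Set
IsSudokuColouring {n} {k} {G} {S} C₀ =
  ∃! _≗_ λ (c : Fin n → Fin k) →
    Proper G c × (∀ v (p : v ∈ S) → c v ≡ PartialColouring.colour C₀ v p)

-- sn(G) = s; it is defined only for connected G with χ(G) ≥ 2.
record IsSudokuNumber {n : ℕ} (G : Graph n) (s : ℕ) : Set where
  field
    connected : Connected G
    χ         : ℕ
    chromatic : IsChromaticNumber G χ
    χ≥2       : 2 ≤ χ
    attained  : ∃[ S ] ∣ S ∣ ≡ s
                × (∃[ C₀ ] IsSudokuColouring {n} {χ} {G} {S} C₀)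
    minimal   : ∀ S (C₀ : PartialColouring G χ S) → IsSudokuColouring C₀ → s ≤ ∣ S ∣

{-# OPTIONS --safe #-}
-- Every new vertex is joined to two adjacent vertices, so in a 3-colouring its
-- colour is forced to be the third one. Hence the colours of two vertices of
-- the initial triangle determine the whole 3-colouring, and sn ≤ 2. Conversely,
-- a partial colouring of at most one vertex uses at most one colour, and
-- exchanging the two other colours turns any extension into a different one.
module Submission where

open import Defs
open import Data.Fin using (Fin; zero; suc; toℕ)
open import Data.Fin.Properties using (_≟_; all?; injective⇒≤)
open import Data.Fin.Subset using (Subset; _∈_; ∣_∣; ⁅_⁆; inside; outside)
open import Data.Fin.Subset.Properties using (∣⁅x⁆∣≡1; p⊆q⇒∣p∣≤∣q∣; x∈⁅y⁆⇒x≡y)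
open import Data.Nat using (ℕ; suc; _+_; _*_; _≤_; _<_; _≥_; s≤s; z≤n; s≤s⁻¹; _≤?_)
open import Data.Nat.DivMod using (_mod_)
open import Data.Nat.Properties using (<⇒≱; ≰⇒>)
open import Data.Product using (∃-syntax; Σ-syntax; _×_; _,_)
open import Data.Sum using (inj₁; inj₂)
open import Data.Vec using ([]; _∷_; here; there)
open import Function using (_∘_; id)
open import Relation.Binary.Construct.Closure.ReflexiveTransitive using (ε; _◅_)
open import Relation.Binary.PropositionalEquality
  using (_≡_; _≢_; _≗_; refl; sym; trans; cong; subst; module ≡-Reasoning)
open import Relation.Nullary using (yes; no; contradiction)
open import Relation.Nullary.Decidable using (from-yes; ¬?; _→-dec_; decidable-stable)

infixl 7 _⋆_

-- The midpoint operation of ℤ/3: for a ≢ b it is the third colour, and a ⋆_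
-- fixes a and exchanges the two other colours.
_⋆_ : Fin 3 → Fin 3 → Fin 3
a ⋆ b = (2 * (toℕ a + toℕ b)) mod 3

⋆-idem : ∀ a → a ⋆ a ≡ a
⋆-idem = from-yes (all? λ a → a ⋆ a ≟ a)

⋆-involutive : ∀ a b → a ⋆ (a ⋆ b) ≡ b
⋆-involutive = from-yes (all? λ a → all? λ b → a ⋆ (a ⋆ b) ≟ b)

⋆-injective : ∀ a {b c} → a ⋆ b ≡ a ⋆ c → b ≡ c
⋆-injective a {b} {c} eq = begin
  b           ≡⟨ ⋆-involutive a b ⟨
  a ⋆ (a ⋆ b) ≡⟨ cong (a ⋆_) eq ⟩
  a ⋆ (a ⋆ c) ≡⟨ ⋆-involutive a c ⟩
  c           ∎
  where open ≡-Reasoning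

⋆-fixed : ∀ a b → a ⋆ b ≡ b → a ≡ b
⋆-fixed = from-yes (all? λ a → all? λ b → (a ⋆ b ≟ b) →-dec (a ≟ b))

⋆-fixedˡ : ∀ a b → a ⋆ b ≡ a → a ≡ b
⋆-fixedˡ = from-yes (all? λ a → all? λ b → (a ⋆ b ≟ a) →-dec (a ≟ b))

⋆-third : ∀ a b c → a ≢ b → c ≢ a → c ≢ b → a ⋆ b ≡ c
⋆-third = from-yes (all? λ a → all? λ b → all? λ c →
  ¬? (a ≟ b) →-dec (¬? (c ≟ a) →-dec (¬? (c ≟ b) →-dec (a ⋆ b ≟ c))))

Triangle : ∀ {n} → Graph n → Set
Triangle {n} G = Σ[ t ∈ (Fin 3 → Fin n) ] (∀ a b → a ≢ b → Adj G (t a) (t b))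

-- The corners of a triangle are pairwise adjacent, so `c ∘ t` is injective on `Fin 3`.
triangle⇒3≤colours : ∀ {n m} {G : Graph n} → Triangle G →
                     (c : Fin n → Fin m) → Proper G c → 3 ≤ m
triangle⇒3≤colours (t , t-adj) c c-proper = injective⇒≤ {f = c ∘ t} λ {a} {b} eq →
  decidable-stable (a ≟ b) λ a≢b → c-proper (t-adj a b a≢b) eq

-- The direction of `c ≗ c′` is that of the uniqueness clause of `∃!`.
Determines : ∀ {n} → Graph n → Subset n → (Fin n → Fin 3) → Set
Determines G S c = ∀ {c′} → Proper G c′ → (∀ v → v ∈ S → c′ v ≡ c v) → c ≗ c′

-- When `u` and `v` are adjacent and `c` is proper, the new vertex gets the only colour that its two
-- neighbours leave free.
extend : ∀ {n} → Fin n → Fin n → (Fin n → Fin 3) → Fin (suc n) → Fin 3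
extend u v c zero    = c u ⋆ c v
extend u v c (suc w) = c w

module _ {n : ℕ} {G : Graph n} {u v : Fin n} (uv : Adj G u v) where

  extend-proper : ∀ {c} → Proper G c → Proper (addVertex G u v) (extend u v c)
  extend-proper c-proper {zero} {suc w} (inj₁ refl) = c-proper uv ∘ ⋆-fixedˡ _ _
  extend-proper c-proper {zero} {suc w} (inj₂ refl) = c-proper uv ∘ ⋆-fixed _ _
  extend-proper c-proper {suc w} {zero} (inj₁ refl) = c-proper uv ∘ ⋆-fixedˡ _ _ ∘ sym
  extend-proper c-proper {suc w} {zero} (inj₂ refl) = c-proper uv ∘ ⋆-fixed _ _ ∘ sym
  extend-proper c-proper {suc w} {suc t} e = c-proper e

  -- On the old vertices `c′` equals `c` by `det`. The new vertex must then avoid the distinct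
  -- colours `c u` and `c v`, which leaves one choice; it can therefore stay outside the precoloured
  -- set.
  extend-determined : ∀ {S c} → Proper G c → Determines G S c →
    Determines (addVertex G u v) (outside ∷ S) (extend u v c)
  extend-determined {S} {c} c-proper det {c′} c′-proper agree = λ where
      zero    → ⋆-third _ _ _ (c-proper uv) (new≢ u (inj₁ refl)) (new≢ v (inj₂ refl))
      (suc w) → c≗c′ w
    where
    c≗c′ : c ≗ c′ ∘ suc
    c≗c′ = det (λ {a} {b} e → c′-proper {suc a} {suc b} e)
               (λ w w∈S → agree (suc w) (there w∈S))

    new≢ : ∀ w → Adj (addVertex G u v) zero (suc w) → c′ zero ≢ c w
    new≢ w e eq = c′-proper {zero} {suc w} e (trans eq (c≗c′ w))

K₃-determined : Determines (K 3) (inside ∷ inside ∷ outside ∷ []) id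
K₃-determined {c′} c′-proper agree = λ where
    zero             → sym c′0≡0
    (suc zero)       → sym c′1≡1
    (suc (suc zero)) → ⋆-third zero (suc zero) _ (λ ())
      (λ eq → c′-proper (λ ()) (trans eq (sym c′0≡0)))
      (λ eq → c′-proper (λ ()) (trans eq (sym c′1≡1)))
  where
  c′0≡0 = agree zero here
  c′1≡1 = agree (suc zero) (there here)

triangulated⇒triangle : ∀ {i G P} → Triangulated i G P → Triangle G
triangulated⇒triangle (base P) = id , λ _ _ → id
triangulated⇒triangle (step T u v uv P′ _ _ _) =
  let t , t-adj = triangulated⇒triangle T in suc ∘ t , t-adj

triangulated⇒connected : ∀ {i G P} → Triangulated i G P → Connected G
triangulated⇒connected (base P) u v with u ≟ v
... | yes refl = ε
... | no  u≢v  = u≢v ◅ ε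
triangulated⇒connected (step T u v uv P′ _ (_ , connected , _) _) = connected

triangulated⇒determined : ∀ {i G P} → Triangulated i G P →
  ∃[ S ] ∃[ c ] ∣ S ∣ ≡ 2 × Proper G c × Determines G S c
-- Adjacency in `K 3` is `_≢_`, so the first `id` is the colouring and the second its properness.
triangulated⇒determined (base P) = _ , id , refl , id , K₃-determined
triangulated⇒determined (step {G = G} T u v uv P′ _ _ _) =
  let S , c , ∣S∣≡2 , c-proper , det = triangulated⇒determined T
  in outside ∷ S , extend u v c , ∣S∣≡2
   , (λ {a} {b} → extend-proper {G = G} uv c-proper {a} {b})
   , extend-determined {G = G} uv c-proper det

x∈p⇒0<∣p∣ : ∀ {n} {p : Subset n} {x} → x ∈ p → 0 < ∣ p ∣
x∈p⇒0<∣p∣ {p = p} {x} x∈p = subst (_≤ ∣ p ∣) (∣⁅x⁆∣≡1 x)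
  (p⊆q⇒∣p∣≤∣q∣ λ y∈⁅x⁆ → subst (_∈ p) (sym (x∈⁅y⁆⇒x≡y x y∈⁅x⁆)) x∈p)

∣S∣<2⇒monochromatic : ∀ {n k} (S : Subset n) → ∣ S ∣ < 2 → (c : Fin n → Fin (suc k)) →
                      ∃[ a ] (∀ v → v ∈ S → c v ≡ a)
-- With no vertex in the set any colour will do; the palette `Fin (suc k)` provides `zero` as a
-- default.
∣S∣<2⇒monochromatic []            _    c = zero , λ _ ()
∣S∣<2⇒monochromatic (outside ∷ S) S<2 c =
  let a , mono = ∣S∣<2⇒monochromatic S S<2 (c ∘ suc)
  in a , λ { (suc v) (there v∈S) → mono v v∈S }
∣S∣<2⇒monochromatic (inside ∷ S)  S<2 c = c zero , λ where
  zero    _           → refl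
  -- The first vertex already accounts for the one allowed element, so the tail of the set is empty.
  (suc v) (there v∈S) → contradiction (s≤s⁻¹ (s≤s⁻¹ S<2)) (<⇒≱ (x∈p⇒0<∣p∣ v∈S))

sudoku⇒2≤∣S∣ : ∀ {n} {G : Graph n} {u v} → Adj G u v →
  (S : Subset n) (C₀ : PartialColouring G 3 S) → IsSudokuColouring C₀ → 2 ≤ ∣ S ∣
sudoku⇒2≤∣S∣ {u = u} {v} uv S C₀ (c , (c-proper , agree) , unique) =
  decidable-stable (2 ≤? ∣ S ∣) λ S≱2 →
    let a , mono = ∣S∣<2⇒monochromatic S (≰⇒> S≱2) c
        -- The swap `a ⋆_` is injective, so it keeps `c` proper, and it fixes `a`, the only colour
        -- prescribed on `S`. Uniqueness then gives `c` back.
        c≗a⋆c = unique {(a ⋆_) ∘ c}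
          ( (λ e → c-proper e ∘ ⋆-injective a)
          , λ w w∈S → begin
              a ⋆ c w ≡⟨ cong (a ⋆_) (mono w w∈S) ⟩
              a ⋆ a   ≡⟨ ⋆-idem a ⟩
              a       ≡⟨ mono w w∈S ⟨
              c w     ≡⟨ agree w w∈S ⟩
              PartialColouring.colour C₀ w w∈S ∎ )
        -- Only `a` is fixed by the swap, so `c` would be constant, which the edge `uv` forbids.
        c≡a = λ w → sym (⋆-fixed a (c w) (sym (c≗a⋆c w)))
    in c-proper uv (trans (c≡a u) (sym (c≡a v)))
  where open ≡-Reasoning

theorem3p12 : (i : ℕ) → i ≥ 1 → (G : Graph (2 + i)) (P : PlaneGraph G) →
    Triangulated i G P → IsSudokuNumber G 2
theorem3p12 i _ G P T =
  let t , t-adj = triangulated⇒triangle T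
      S , c , ∣S∣≡2 , c-proper , det = triangulated⇒determined T
  in record
  { connected = triangulated⇒connected T
  ; χ         = 3
  -- The determined colouring shows that three colours suffice; the triangle shows that fewer do
  -- not.
  ; chromatic = (c , c-proper) , λ m → triangle⇒3≤colours {G = G} (t , t-adj)
  ; χ≥2       = s≤s (s≤s z≤n)
  ; attained  = S , ∣S∣≡2
      , record { colour = λ v _ → c v ; proper = λ _ _ → c-proper }
      , c , (c-proper , λ _ _ → refl) , λ (c′-proper , agree) → det c′-proper agree
  ; minimal   = sudoku⇒2≤∣S∣ {G = G} (t-adj zero (suc zero) λ ())
  }
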